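{- Let $n\ge 6$ with $3\mid n$. Then the metric dimension of $H(n)$ is $n-\frac{n}{3}$.
   Context: For $n\ge 5$, $H(n)$ is the graph with vertex set $V_1\cup V_2$, where $V_1=\{v_1,\dots,v_n\}$ and $V_2=\{v_iv_j: 1\le i<j\le n\}$ (each $v_iv_j$ a single vertex), and where $v_r\in V_1$ is adjacent to $v_iv_j\in V_2$ iff $r=i$ or $r=j$; there are no other edges. $d(u,v)$ is the shortest-path distance. A set $Q$ of vertices is a resolving set of a graph $G$ if any two distinct vertices $x,y$ satisfy $(d(x,q))_{q\in Q}\neq(d(y,q))_{q\in Q}$; the metric dimension is the minimum size of a resolving set. -}

module Defs where

open import Data.Empty using (⊥)
open import Data.Fin.Base using (Fin; _<_)
open import Data.List.Base using (List; length)
open import Data.List.Membership.Propositional using (_∈_)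
open import Data.List.Relation.Unary.Unique.Propositional using (Unique)
open import Data.Nat.Base using (ℕ; zero; suc; _≤_)
open import Data.Product.Base using (_×_; ∃-syntax)
open import Data.Sum.Base using (_⊎_)
open import Function.Bundles using (_⇔_)
open import Relation.Binary.Definitions using (Symmetric; Irreflexive)
open import Relation.Binary.PropositionalEquality.Core using (_≡_; _≢_; refl)
open import Relation.Nullary.Negation.Core using (¬_)

record Graph : Set₁ where
  field
    Vertex : Set
    Adj    : Vertex → Vertex → Set
    sym    : Symmetric Adj
    irrefl : Irreflexive _≡_ Adj

IsMinimum : (ℕ → Set) → ℕ → Set
IsMinimum P k = P k × (∀ m → P m → k ≤ m)

module _ (G : Graph) where
  open Graph G

  data Walk : Vertex → Vertex → ℕ → Set where
    []  : ∀ {u} → Walk u u zero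
    _∷_ : ∀ {u v w k} → Adj u v → Walk v w k → Walk u w (suc k)

  -- d(u,v) = k.  A shortest walk repeats no vertex, so minimising over walks
  -- is the same as minimising over paths.
  IsDistance : Vertex → Vertex → ℕ → Set
  IsDistance u v = IsMinimum (Walk u v)

  -- d(x,q) = d(y,q).  Vertices in different components have no distance k, so
  -- this agrees with the convention d = ∞ there.
  SameDistance : Vertex → Vertex → Vertex → Set
  SameDistance x y q = ∀ k → IsDistance x q k ⇔ IsDistance y q k

  IsResolving : List Vertex → Set
  IsResolving Q = ∀ x y → x ≢ y → ¬ (∀ q → q ∈ Q → SameDistance x y q)

  -- A finite set of vertices is a list without repetitions; its size is the
  -- length of the list.
  HasResolvingSetOfSize : ℕ → Set
  HasResolvingSetOfSize m = ∃[ Q ] (Unique Q × IsResolving Q × length Q ≡ m)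

  IsMetricDimension : ℕ → Set
  IsMetricDimension = IsMinimum HasResolvingSetOfSize

-- The proof of i < j is irrelevant, so that each pair is a single vertex.
data HVertex (n : ℕ) : Set where
  point : Fin n → HVertex n
  pair  : (i j : Fin n) → .(i < j) → HVertex n

HAdj : ∀ {n} → HVertex n → HVertex n → Set
HAdj (point r)    (pair i j _) = r ≡ i ⊎ r ≡ j
HAdj (pair i j _) (point r)    = r ≡ i ⊎ r ≡ j
HAdj (point _)    (point _)    = ⊥
HAdj (pair _ _ _) (pair _ _ _) = ⊥

HAdj-sym : ∀ {n} → Symmetric (HAdj {n})
HAdj-sym {_} {point _}    {pair _ _ _} a = a
HAdj-sym {_} {pair _ _ _} {point _}    a = a

HAdj-irrefl : ∀ {n} → Irreflexive _≡_ (HAdj {n})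
HAdj-irrefl {_} {point _}    refl ()
HAdj-irrefl {_} {pair _ _ _} refl ()

H : ℕ → Graph
H n = record
  { Vertex = HVertex n
  ; Adj    = HAdj
  ; sym    = HAdj-sym
  ; irrefl = HAdj-irrefl
  }

{-# OPTIONS --safe #-}

-- H(n) is the subdivided complete graph K_n, so a set Q of its vertices is a set of
-- loops (points) and edges (pairs) on [n], and the distances to Q only record
-- incidences.
--
-- Lower bound: give v weight 2 if it has degree 1 in Q, and weight 1 otherwise.  An
-- edge of Q whose two ends both have degree 1 cannot separate its ends, so every
-- member of Q carries weight at most 3, while every covered point receives degree
-- times weight at least 2.  At most one point is uncovered, whence
-- 2n ≤ 3|Q| + 2, and |Q| ≥ 2n/3 because 3 divides n.
--
-- Upper bound: cut [n] into blocks of three and put a path with two edges on each.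
-- The only ambiguity within a block is between the middle point and the two outer
-- points together, and it cannot occur between two sets of the same size.

module Submission where

open import Defs
open import Data.Nat.Base using (ℕ; _≥_; _∸_; _/_)
open import Data.Nat.Divisibility.Core using (_∣_)

open import Data.Bool.Base using (Bool; true; false; _∧_; _∨_; if_then_else_)
open import Data.Bool.Properties using (∧-distribˡ-∨)
import Data.Bool.Properties as Bool
open import Data.Empty using (⊥-elim-irr)
open import Data.Fin.Base using (Fin; zero; suc; inject₁; combine; remQuot; toℕ) renaming (_<_ to _<ᶠ_)
open import Data.Fin.Patterns using (0F; 1F; 2F)
import Data.Fin.Properties as Fin
open import Data.List.Base using (List; []; _∷_; length; tabulate)
open import Data.List.Membership.Propositional using (_∈_)
open import Data.List.Membership.Propositional.Properties using (∈-tabulate⁺)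
open import Data.List.Properties using (length-tabulate)
open import Data.List.Relation.Unary.Any using (here; there)
open import Data.List.Relation.Unary.Unique.Propositional using (Unique)
open import Data.List.Relation.Unary.Unique.Propositional.Properties using (tabulate⁺)
open import Data.Nat.Base using (zero; suc; _+_; _*_; _≤_; z≤n; s≤s)
open import Data.Nat.Divisibility.Core using (divides)
open import Data.Nat.DivMod using (m*n/n≡m)
import Data.Nat.Properties as ℕ
open import Data.Product.Base using (_×_; _,_; ∃-syntax; uncurry)
open import Data.Sum.Base using (_⊎_; inj₁; inj₂; swap)
open import Function.Base using (_∘_)
open import Function.Bundles using (mk⇔; module Equivalence)
open import Relation.Binary.Definitions using (tri<; tri≈; tri>)
open import Relation.Binary.PropositionalEquality
open import Relation.Nullary.Decidable using (Dec; yes; no; does; does-⇔; dec-true; dec-false; from-yes; _⊎-dec_; _→-dec_; _×-dec_; ¬?)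
open import Relation.Nullary.Negation using (¬_; contradiction)

open import Algebra.Properties.CommutativeMonoid.Sum ℕ.+-0-commutativeMonoid
  using (sum; sum-syntax; sum-cong-≗; ∑-distrib-+)

private variable
  n : ℕ

-- Incidence of vertices with points.

Incident : HVertex n → Fin n → Set
Incident (point r)    v = v ≡ r
Incident (pair i j _) v = v ≡ i ⊎ v ≡ j

incident? : (q : HVertex n) (v : Fin n) → Dec (Incident q v)
incident? (point r)    v = v Fin.≟ r
incident? (pair i j _) v = (v Fin.≟ i) ⊎-dec (v Fin.≟ j)

inc : HVertex n → Fin n → Bool
inc q v = does (incident? q v)

does⇒ : ∀ {a} {A : Set a} (a? : Dec A) → does a? ≡ true → A
does⇒ (yes a) _ = a

inc⇒ : ∀ (q : HVertex n) v → inc q v ≡ true → Incident q v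
inc⇒ q v = does⇒ (incident? q v)

⇒inc : ∀ (q : HVertex n) {v} → Incident q v → inc q v ≡ true
⇒inc q {v} = dec-true (incident? q v)

¬inc⇒ : ∀ (q : HVertex n) {v} → inc q v ≡ false → ¬ Incident q v
¬inc⇒ q q∌v v∈q = contradiction (trans (sym (⇒inc q v∈q)) q∌v) λ ()

-- Of the four ways to match `i` and `j` with `k` and `l`, irreflexivity of `<` excludes the two
-- that identify `i` with `j`, and asymmetry excludes the crossed one.
pair-determined : ∀ {i j k l : Fin n} .(i<j : i <ᶠ j) .(k<l : k <ᶠ l) →
  inc (pair k l k<l) i ≡ true → inc (pair k l k<l) j ≡ true → pair i j i<j ≡ pair k l k<l
pair-determined {i = i} {j} {k} {l} i<j k<l p q
  with inc⇒ (pair k l k<l) i p | inc⇒ (pair k l k<l) j q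
... | inj₁ refl | inj₂ refl = refl
... | inj₁ refl | inj₁ refl = ⊥-elim-irr (Fin.<-irrefl refl i<j)
... | inj₂ refl | inj₂ refl = ⊥-elim-irr (Fin.<-irrefl refl i<j)
... | inj₂ refl | inj₁ refl = ⊥-elim-irr (Fin.<-asym i<j k<l)

-- Distances in closed form.

-- Subscripts: 0 for a point, 1 for a pair; the arguments are incidences.
dist₀₀ dist₀₁ : Bool → ℕ
dist₀₀ b = if b then 0 else 2
dist₀₁ b = if b then 1 else 3

dist₁₁ : Bool → Bool → ℕ
dist₁₁ true  b = if b then 0 else 2
dist₁₁ false b = if b then 2 else 4

dist : HVertex n → HVertex n → ℕ
dist (point r)    q@(point _)    = dist₀₀ (inc q r)
dist (point r)    q@(pair _ _ _) = dist₀₁ (inc q r)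
dist (pair i j _) q@(pair _ _ _) = dist₁₁ (inc q i) (inc q j)
dist (pair i j p) (point s)      = dist₀₁ (inc (pair i j p) s)

dist-refl : (u : HVertex n) → dist u u ≡ 0
dist-refl (point r) = cong dist₀₀ (⇒inc (point r) refl)
dist-refl u@(pair i j _) = cong₂ dist₁₁ (⇒inc u (inj₁ refl)) (⇒inc u (inj₂ refl))

private
  dist₀₀≤1+dist₀₁ : ∀ a b → dist₀₀ a ≤ 1 + dist₀₁ b
  dist₀₀≤1+dist₀₁ true  _     = z≤n
  dist₀₀≤1+dist₀₁ false true  = s≤s (s≤s z≤n)
  dist₀₀≤1+dist₀₁ false false = s≤s (s≤s z≤n)

  dist₀₁≤3 : ∀ a → dist₀₁ a ≤ 3
  dist₀₁≤3 true  = s≤s z≤n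
  dist₀₁≤3 false = ℕ.≤-refl

  dist₀₁≤1+dist₁₁ : ∀ a b → dist₀₁ a ≤ 1 + dist₁₁ a b
  dist₀₁≤1+dist₁₁ true  _     = s≤s z≤n
  dist₀₁≤1+dist₁₁ false true  = ℕ.≤-refl
  dist₀₁≤1+dist₁₁ false false = s≤s (s≤s (s≤s z≤n))

  dist₁₁≤1+dist₀₁ : ∀ a b → dist₁₁ a b ≤ 1 + dist₀₁ a
  dist₁₁≤1+dist₀₁ true  true  = z≤n
  dist₁₁≤1+dist₀₁ true  false = ℕ.≤-refl
  dist₁₁≤1+dist₀₁ false true  = s≤s (s≤s z≤n)
  dist₁₁≤1+dist₀₁ false false = ℕ.≤-refl

  dist₁₁-comm : ∀ a b → dist₁₁ a b ≡ dist₁₁ b a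
  dist₁₁-comm true  true  = refl
  dist₁₁-comm true  false = refl
  dist₁₁-comm false true  = refl
  dist₁₁-comm false false = refl

-- Since `dist` vanishes on the diagonal and drops by at most one along an edge, induction on a walk
-- bounds `dist` by its length; this is `dist≤walk`.
dist-step : ∀ {u v : HVertex n} → HAdj u v → ∀ w → dist u w ≤ 1 + dist v w
dist-step {u = point r} {v@(pair _ _ _)} _ w@(point s) = dist₀₀≤1+dist₀₁ (inc w r) (inc v s)
dist-step {u = point _} {pair i j _} (inj₁ refl) w@(pair _ _ _) =
  dist₀₁≤1+dist₁₁ (inc w i) (inc w j)
dist-step {u = point _} {pair i j _} (inj₂ refl) w@(pair _ _ _)
  rewrite dist₁₁-comm (inc w i) (inc w j) = dist₀₁≤1+dist₁₁ (inc w j) (inc w i)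
dist-step {u = u@(pair _ _ _)} {point r} r∈u (point s) with r Fin.≟ s
... | yes refl rewrite ⇒inc u r∈u = ℕ.≤-refl
-- Distinct points are 2 apart, so the right-hand side is 3, the largest value of `dist₀₁`.
... | no  _    = dist₀₁≤3 (inc u s)
dist-step {u = pair i j _} {point _} (inj₁ refl) w@(pair _ _ _) =
  dist₁₁≤1+dist₀₁ (inc w i) (inc w j)
dist-step {u = pair i j _} {point _} (inj₂ refl) w@(pair _ _ _)
  rewrite dist₁₁-comm (inc w i) (inc w j) = dist₁₁≤1+dist₀₁ (inc w j) (inc w i)

dist≤walk : ∀ {u v : HVertex n} {k} → Walk (H n) u v k → dist u v ≤ k
dist≤walk {u = u} []    = ℕ.≤-reflexive (dist-refl u)
dist≤walk {v = v} (a ∷ w) = ℕ.≤-trans (dist-step a v) (s≤s (dist≤walk w))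

walk₀₀ : ∀ {r s : Fin n} {k v} → r ≢ s → Walk (H n) (point s) v k → Walk (H n) (point r) v (2 + k)
walk₀₀ {r = r} {s} r≢s w with Fin.<-cmp r s
... | tri< r<s _ _ = _∷_ {v = pair r s r<s} (inj₁ refl) (inj₂ refl ∷ w)
... | tri≈ _ r≡s _ = contradiction r≡s r≢s
... | tri> _ _ s<r = _∷_ {v = pair s r s<r} (inj₂ refl) (inj₁ refl ∷ w)

walk₀₁ : ∀ (r : Fin n) k l .(k<l : k <ᶠ l) → Walk (H n) (point r) (pair k l k<l) (dist₀₁ (inc (pair k l k<l) r))
walk₀₁ r k l k<l with inc (pair k l k<l) r in eq
... | true  = inc⇒ (pair k l k<l) r eq ∷ []
... | false = walk₀₀ (¬inc⇒ (pair k l k<l) eq ∘ inj₁) (inj₁ refl ∷ [])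

walk₁₀ : ∀ i j .(i<j : i <ᶠ j) (s : Fin n) → Walk (H n) (pair i j i<j) (point s) (dist₀₁ (inc (pair i j i<j) s))
walk₁₀ i j i<j s with inc (pair i j i<j) s in eq
... | true  = inc⇒ (pair i j i<j) s eq ∷ []
... | false = inj₁ refl ∷ walk₀₀ (¬inc⇒ (pair i j i<j) eq ∘ inj₁ ∘ sym) []

shortest-walk : (u v : HVertex n) → Walk (H n) u v (dist u v)
shortest-walk (point r) (point s) with r Fin.≟ s
... | yes refl = []
... | no  r≢s  = walk₀₀ r≢s []
shortest-walk (point r)    (pair k l k<l) = walk₀₁ r k l k<l
shortest-walk (pair i j i<j) (point s)    = walk₁₀ i j i<j s
shortest-walk (pair i j i<j) (pair k l k<l)
  -- The walks are abstracted along with the incidences so that their lengths reduce too. An end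
  -- lying in the second pair gives the shorter route.
  with inc (pair k l k<l) i in p | inc (pair k l k<l) j in q
     | walk₀₁ i k l k<l | walk₀₁ j k l k<l
... | true  | true  | _ | _ rewrite pair-determined i<j k<l p q = []
... | true  | false | w | _ = inj₁ refl ∷ w
... | false | true  | _ | w = inj₂ refl ∷ w
... | false | false | w | _ = inj₁ refl ∷ w

dist-isDistance : (u v : HVertex n) → IsDistance (H n) u v (dist u v)
dist-isDistance u v = shortest-walk u v , λ _ → dist≤walk

isDistance⇒≡dist : ∀ {u v : HVertex n} {k} → IsDistance (H n) u v k → k ≡ dist u v
isDistance⇒≡dist {u = u} {v} (w , minimal) =
  ℕ.≤-antisym (minimal _ (shortest-walk u v)) (dist≤walk w)

≡dist⇒sameDistance : ∀ {x y q : HVertex n} → dist x q ≡ dist y q → SameDistance (H n) x y q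
≡dist⇒sameDistance {x = x} {y} {q} eq k = mk⇔
  (λ d → subst (IsDistance _ y q) (sym (trans (isDistance⇒≡dist d) eq)) (dist-isDistance y q))
  (λ d → subst (IsDistance _ x q) (sym (trans (isDistance⇒≡dist d) (sym eq))) (dist-isDistance x q))

sameDistance⇒≡dist : ∀ {x y q : HVertex n} → SameDistance (H n) x y q → dist x q ≡ dist y q
sameDistance⇒≡dist {x = x} {q = q} same =
  isDistance⇒≡dist (Equivalence.to (same _) (dist-isDistance x q))

-- Finite sums and indicators.

∑-mono : {f g : Fin n → ℕ} → (∀ i → f i ≤ g i) → sum f ≤ sum g
∑-mono {zero}  f≤g = z≤n
∑-mono {suc n} f≤g = ℕ.+-mono-≤ (f≤g zero) (∑-mono (f≤g ∘ suc))

∑-const : ∀ n c → ∑[ i < n ] c ≡ n * c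
∑-const zero    c = refl
∑-const (suc n) c = cong (c +_) (∑-const n c)

bit : Bool → ℕ
bit b = if b then 1 else 0

bit-∨ : ∀ a b → bit (a ∨ b) ≤ bit a + bit b
bit-∨ true  b = s≤s z≤n
bit-∨ false b = ℕ.≤-refl

∑-indicator : (r : Fin n) (W : Fin n → ℕ) → ∑[ v < n ] (bit (does (v Fin.≟ r)) * W v) ≡ W r
∑-indicator {suc n} zero W = begin
  W zero + 0 + ∑[ v < n ] 0 ≡⟨ cong₂ _+_ (ℕ.+-identityʳ (W zero)) (trans (∑-const n 0) (ℕ.*-zeroʳ n)) ⟩
  W zero + 0                ≡⟨ ℕ.+-identityʳ (W zero) ⟩
  W zero                    ∎
  where open ≡-Reasoning
∑-indicator {suc n} (suc r) W = ∑-indicator r (W ∘ suc)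

-- Degrees and double counting.

degree : List (HVertex n) → Fin n → ℕ
degree []      v = 0
degree (q ∷ Q) v = bit (inc q v) + degree Q v

degree≡0⇒inc≡false : ∀ (Q : List (HVertex n)) {v} → degree Q v ≡ 0 → ∀ {q} → q ∈ Q → inc q v ≡ false
degree≡0⇒inc≡false (p ∷ Q) {v} d≡0 q∈Q with inc p v in p∌v
degree≡0⇒inc≡false (p ∷ Q) {v} d≡0 (here refl) | false = p∌v
degree≡0⇒inc≡false (p ∷ Q) {v} d≡0 (there q∈Q) | false = degree≡0⇒inc≡false Q d≡0 q∈Q

-- Once the head is incident with `v`, the tail has degree 0 at `v`, so both members can only be the
-- head.
degree≡1⇒unique : ∀ (Q : List (HVertex n)) {v} → degree Q v ≡ 1 →
  ∀ {p q} → p ∈ Q → q ∈ Q → inc p v ≡ true → inc q v ≡ true → p ≡ q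
degree≡1⇒unique (r ∷ Q) {v} d≡1 p∈Q q∈Q v∈p v∈q with inc r v in eq
degree≡1⇒unique (r ∷ Q) d≡1 (here refl) (here refl) v∈p v∈q | _ = refl
degree≡1⇒unique (r ∷ Q) d≡1 (here refl) (there q∈Q) v∈p v∈q | true =
  contradiction (trans (sym v∈q) (degree≡0⇒inc≡false Q (ℕ.suc-injective d≡1) q∈Q)) λ ()
degree≡1⇒unique (r ∷ Q) d≡1 (there p∈Q) _           v∈p v∈q | true =
  contradiction (trans (sym v∈p) (degree≡0⇒inc≡false Q (ℕ.suc-injective d≡1) p∈Q)) λ ()
degree≡1⇒unique (r ∷ Q) d≡1 (here refl) (there q∈Q) v∈p v∈q | false =
  contradiction (trans (sym v∈p) eq) λ ()
degree≡1⇒unique (r ∷ Q) d≡1 (there p∈Q) (here refl) v∈p v∈q | false =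
  contradiction (trans (sym v∈q) eq) λ ()
degree≡1⇒unique (r ∷ Q) d≡1 (there p∈Q) (there q∈Q) v∈p v∈q | false =
  degree≡1⇒unique Q d≡1 p∈Q q∈Q v∈p v∈q

load : (Fin n → ℕ) → HVertex n → ℕ
load {n} W q = ∑[ v < n ] (bit (inc q v) * W v)

load-pair : ∀ (W : Fin n → ℕ) i j .(i<j : i <ᶠ j) → load W (pair i j i<j) ≤ W i + W j
load-pair {n} W i j i<j = begin
  ∑[ v < n ] (bit (does (v Fin.≟ i) ∨ does (v Fin.≟ j)) * W v)
    ≤⟨ ∑-mono (λ v → ℕ.*-monoˡ-≤ (W v) (bit-∨ (does (v Fin.≟ i)) _)) ⟩
  ∑[ v < n ] ((bit (does (v Fin.≟ i)) + bit (does (v Fin.≟ j))) * W v)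
    ≡⟨ sum-cong-≗ (λ v → ℕ.*-distribʳ-+ (W v) (bit (does (v Fin.≟ i))) _) ⟩
  ∑[ v < n ] (bit (does (v Fin.≟ i)) * W v + bit (does (v Fin.≟ j)) * W v)
    ≡⟨ ∑-distrib-+ (λ v → bit (does (v Fin.≟ i)) * W v) _ ⟩
  ∑[ v < n ] (bit (does (v Fin.≟ i)) * W v) + ∑[ v < n ] (bit (does (v Fin.≟ j)) * W v)
    ≡⟨ cong₂ _+_ (∑-indicator i W) (∑-indicator j W) ⟩
  W i + W j ∎
  where open ℕ.≤-Reasoning

-- Double counting: the weighted degree sum equals the sum of the loads of the entries of `Q`.
∑-degree-≤ : ∀ (W : Fin n → ℕ) {c} Q → (∀ {q} → q ∈ Q → load W q ≤ c) →
  ∑[ v < n ] (degree Q v * W v) ≤ length Q * c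
∑-degree-≤ {n} W [] _ = ℕ.≤-reflexive (trans (∑-const n 0) (ℕ.*-zeroʳ n))
∑-degree-≤ {n} W {c} (q ∷ Q) load≤c = begin
  ∑[ v < n ] ((bit (inc q v) + degree Q v) * W v)
    ≡⟨ sum-cong-≗ (λ v → ℕ.*-distribʳ-+ (W v) (bit (inc q v)) _) ⟩
  ∑[ v < n ] (bit (inc q v) * W v + degree Q v * W v)
    ≡⟨ ∑-distrib-+ (λ v → bit (inc q v) * W v) _ ⟩
  load W q + ∑[ v < n ] (degree Q v * W v)
    ≤⟨ ℕ.+-mono-≤ (load≤c (here refl)) (∑-degree-≤ W Q (load≤c ∘ there)) ⟩
  c + length Q * c ∎
  where open ℕ.≤-Reasoning

-- Lower bound by weights.

inc≡⇒sameDistance : ∀ {x y : Fin n} q → inc q x ≡ inc q y → SameDistance (H n) (point x) (point y) q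
inc≡⇒sameDistance q@(point _)    eq = ≡dist⇒sameDistance {q = q} (cong dist₀₀ eq)
inc≡⇒sameDistance q@(pair _ _ _) eq = ≡dist⇒sameDistance {q = q} (cong dist₀₁ eq)

-- At degree 0 the value 1 is a default; it keeps `weight-+` true for ends not known to be covered.
weight : ℕ → ℕ
weight 1 = 2
weight _ = 1

weight≤2 : ∀ d → weight d ≤ 2
weight≤2 0             = s≤s z≤n
weight≤2 1             = ℕ.≤-refl
weight≤2 (suc (suc _)) = s≤s z≤n

-- Weights are at most 2, so only 2 + 2 could exceed 3, and weight 2 occurs at degree 1 alone.
weight-+ : ∀ c d → ¬ (c ≡ 1 × d ≡ 1) → weight c + weight d ≤ 3
weight-+ 0             d _     = s≤s (weight≤2 d)
weight-+ (suc (suc _)) d _     = s≤s (weight≤2 d)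
weight-+ 1 0             _     = ℕ.≤-refl
weight-+ 1 1             ¬both = contradiction (refl , refl) ¬both
weight-+ 1 (suc (suc _)) _     = ℕ.≤-refl

weighted≥2 : ∀ {d} → d ≢ 0 → 2 ≤ d * weight d
weighted≥2 {0}           d≢0 = contradiction refl d≢0
weighted≥2 {1}           _   = ℕ.≤-refl
weighted≥2 {suc (suc _)} _   = s≤s (s≤s z≤n)

module _ {Q : List (HVertex n)} (resolving : IsResolving (H n) Q) where

  -- The distance from a point to any `q` is a function of their incidence bit, so points with equal
  -- bits are not separated by `q`.
  points-resolved : ∀ {x y} → (∀ {q} → q ∈ Q → inc q x ≡ inc q y) → x ≡ y
  points-resolved {x} {y} same with x Fin.≟ y
  ... | yes x≡y = x≡y
  ... | no  x≢y = contradiction (λ q q∈Q → inc≡⇒sameDistance q (same q∈Q))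
                    (resolving (point x) (point y) λ { refl → x≢y refl })

  uncovered-unique : ∀ {x y} → degree Q x ≡ 0 → degree Q y ≡ 0 → x ≡ y
  uncovered-unique x≡0 y≡0 = points-resolved λ q∈Q →
    trans (degree≡0⇒inc≡false Q x≡0 q∈Q) (sym (degree≡0⇒inc≡false Q y≡0 q∈Q))

  no-isolated-edge : ∀ {i j} .{i<j : i <ᶠ j} → pair i j i<j ∈ Q → ¬ (degree Q i ≡ 1 × degree Q j ≡ 1)
  no-isolated-edge {i} {j} {i<j} e∈Q (i≡1 , j≡1) =
    ⊥-elim-irr (Fin.<-irrefl (points-resolved same) i<j)
    where
    e = pair i j i<j
    i∈e = ⇒inc e {i} (inj₁ refl)
    j∈e = ⇒inc e {j} (inj₂ refl)

    same : ∀ {q} → q ∈ Q → inc q i ≡ inc q j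
    same {q} q∈Q with inc q i in i∈q | inc q j in j∈q
    ... | true  | true  = refl
    ... | false | false = refl
    -- A member through `i` must be `e`, the only one there, and `e` also contains `j`.
    ... | true  | false = contradiction (trans (sym j∈q)
      (subst (λ p → inc p j ≡ true) (degree≡1⇒unique Q i≡1 e∈Q q∈Q i∈e i∈q) j∈e)) λ ()
    ... | false | true  = contradiction (trans (sym i∈q)
      (subst (λ p → inc p i ≡ true) (degree≡1⇒unique Q j≡1 e∈Q q∈Q j∈e j∈q) i∈e)) λ ()

  W : Fin n → ℕ
  W = weight ∘ degree Q

  load≤3 : ∀ {q} → q ∈ Q → load W q ≤ 3
  load≤3 {point r} _ = ℕ.≤-trans (ℕ.≤-reflexive (∑-indicator r W)) (ℕ.m≤n⇒m≤1+n (weight≤2 (degree Q r)))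
  load≤3 {pair i j i<j} e∈Q = ℕ.≤-trans (load-pair W i j i<j)
    (weight-+ (degree Q i) (degree Q j) (no-isolated-edge e∈Q))

  resolving-size : n * 2 ≤ length Q * 3 + 2
  resolving-size with Fin.any? (λ v → degree Q v ℕ.≟ 0)
  ... | no covered = begin
    n * 2                            ≡⟨ ∑-const n 2 ⟨
    ∑[ v < n ] 2                     ≤⟨ ∑-mono (λ v → weighted≥2 {degree Q v} λ d≡0 → covered (v , d≡0)) ⟩
    ∑[ v < n ] (degree Q v * W v)    ≤⟨ ∑-degree-≤ W Q load≤3 ⟩
    length Q * 3                     ≤⟨ ℕ.m≤m+n _ 2 ⟩
    length Q * 3 + 2                 ∎
    where open ℕ.≤-Reasoning
  ... | yes (u , u≡0) = begin
    n * 2                            ≡⟨ ∑-const n 2 ⟨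
    ∑[ v < n ] 2                     ≤⟨ ∑-mono charge≥2 ⟩
    -- The uncovered `u` has no charge of its own. The added term supplies the 2 that it lacks, and
    -- its sum is the final `+ 2`.
    ∑[ v < n ] (degree Q v * W v + bit (does (v Fin.≟ u)) * 2)
      ≡⟨ ∑-distrib-+ (λ v → degree Q v * W v) _ ⟩
    ∑[ v < n ] (degree Q v * W v) + ∑[ v < n ] (bit (does (v Fin.≟ u)) * 2)
      ≤⟨ ℕ.+-mono-≤ (∑-degree-≤ W Q load≤3) (ℕ.≤-reflexive (∑-indicator u (λ _ → 2))) ⟩
    length Q * 3 + 2                 ∎
    where
    open ℕ.≤-Reasoning
    charge≥2 : ∀ v → 2 ≤ degree Q v * W v + bit (does (v Fin.≟ u)) * 2
    charge≥2 v with v Fin.≟ u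
    ... | yes _   = ℕ.m≤n+m 2 _
    ... | no  v≢u = ℕ.m≤n⇒m≤n+o 0 (weighted≥2 {degree Q v} λ v≡0 → v≢u (uncovered-unique v≡0 u≡0))

-- If `m < 2k`, then `3m + 3 ≤ 6k`, so a slack of 2 is too small: after rounding, the uncovered
-- point gains nothing.
lower-bound : ∀ k m → k * 3 * 2 ≤ m * 3 + 2 → k * 2 ≤ m
lower-bound k m 6k≤3m+2 = ℕ.≮⇒≥ λ m<2k → ℕ.<-irrefl refl (begin-strict
  m * 3 + 2   <⟨ ℕ.≤-reflexive (cong suc (ℕ.+-comm (m * 3) 2)) ⟩
  suc m * 3   ≤⟨ ℕ.*-monoˡ-≤ 3 m<2k ⟩
  k * 2 * 3   ≡⟨ ℕ.*-assoc k 2 3 ⟩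
  k * (2 * 3) ≡⟨ ℕ.*-assoc k 3 2 ⟨
  k * 3 * 2   ≤⟨ 6k≤3m+2 ⟩
  m * 3 + 2   ∎)
  where open ℕ.≤-Reasoning

-- Upper bound: one block of three points.

meets : Fin 2 → Fin 3 → Bool
meets σ s = does (s Fin.≟ inject₁ σ) ∨ does (s Fin.≟ suc σ)

meets-some : ∀ s → ∃[ σ ] meets σ s ≡ true
meets-some 0F = 0F , refl
meets-some 1F = 0F , refl
meets-some 2F = 1F , refl

-- Along the path 0 - 1 - 2 the incidence vectors are (1,0), (1,1) and (0,1).
meets-determines : ∀ s r → (∀ σ → meets σ s ≡ meets σ r) → s ≡ r
meets-determines = from-yes (Fin.all? λ s → Fin.all? λ r →
  Fin.all? (λ σ → meets σ s Bool.≟ meets σ r) →-dec (s Fin.≟ r))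

-- The unordered pairs 01, 02 and 12 have the distinct distance vectors (0,2), (2,2) and (2,0).
meets-determines-pair : ∀ s₁ s₂ r₁ r₂ → s₁ ≢ s₂ → r₁ ≢ r₂ →
  (∀ σ → dist₁₁ (meets σ s₁) (meets σ s₂) ≡ dist₁₁ (meets σ r₁) (meets σ r₂)) →
  (s₁ ≡ r₁ × s₂ ≡ r₂) ⊎ (s₁ ≡ r₂ × s₂ ≡ r₁)
meets-determines-pair = from-yes (Fin.all? λ s₁ → Fin.all? λ s₂ → Fin.all? λ r₁ → Fin.all? λ r₂ →
  ¬? (s₁ Fin.≟ s₂) →-dec ¬? (r₁ Fin.≟ r₂) →-dec
  Fin.all? (λ σ → dist₁₁ (meets σ s₁) (meets σ s₂) ℕ.≟ dist₁₁ (meets σ r₁) (meets σ r₂)) →-dec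
  ((s₁ Fin.≟ r₁ ×-dec s₂ Fin.≟ r₂) ⊎-dec (s₁ Fin.≟ r₂ ×-dec s₂ Fin.≟ r₁)))

dist₀₁-injective : ∀ a b → dist₀₁ a ≡ dist₀₁ b → a ≡ b
dist₀₁-injective true  true  _ = refl
dist₀₁-injective false false _ = refl

dist₁₁-cancelʳ : ∀ a b → dist₁₁ a false ≡ dist₁₁ b false → a ≡ b
dist₁₁-cancelʳ true  true  _ = refl
dist₁₁-cancelʳ false false _ = refl

dist₁₁-cancelˡ : ∀ a b → dist₁₁ false a ≡ dist₁₁ false b → a ≡ b
dist₁₁-cancelˡ true  true  _ = refl
dist₁₁-cancelˡ false false _ = refl

-- The value 4 arises exactly when both bits are `false`; a single `true` already gives at most 2.
dist₁₁-occupied : ∀ b c d → dist₁₁ true b ≡ dist₁₁ c d → c ≡ true ⊎ d ≡ true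
dist₁₁-occupied _     true  _    _ = inj₁ refl
dist₁₁-occupied _     false true _ = inj₂ refl
dist₁₁-occupied true  false false ()
dist₁₁-occupied false false false ()

-- Parity: `H n` is bipartite, so the left side is odd and the right side even.
dist₀₁≢dist₁₁ : ∀ a b c → dist₀₁ a ≢ dist₁₁ b c
dist₀₁≢dist₁₁ true  true  true  ()
dist₀₁≢dist₁₁ true  true  false ()
dist₀₁≢dist₁₁ true  false true  ()
dist₀₁≢dist₁₁ true  false false ()
dist₀₁≢dist₁₁ false true  true  ()
dist₀₁≢dist₁₁ false true  false ()
dist₀₁≢dist₁₁ false false true  ()
dist₀₁≢dist₁₁ false false false ()

pair-injectiveˡ : ∀ {i j k l : Fin n} .{p : i <ᶠ j} .{q : k <ᶠ l} → pair i j p ≡ pair k l q → i ≡ k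
pair-injectiveˡ refl = refl

-- Upper bound: separation across blocks.

module _ {k : ℕ} where

  -- The incidence of `edge t σ` with `combine u s`, as `inc-edge` shows. Block and position are
  -- kept as coordinates, away from arithmetic in `Fin (k * 3)`.
  code : Fin k → Fin 2 → Fin k → Fin 3 → Bool
  code t σ u s = does (u Fin.≟ t) ∧ meets σ s

  code-same : ∀ t σ s → code t σ t s ≡ meets σ s
  code-same t σ s = cong (_∧ meets σ s) (dec-true (t Fin.≟ t) refl)

  code-other : ∀ {t u} σ s → u ≢ t → code t σ u s ≡ false
  code-other {t} {u} σ s u≢t = cong (_∧ meets σ s) (dec-false (u Fin.≟ t) u≢t)

  code⇒≡ : ∀ t σ u s → code t σ u s ≡ true → u ≡ t
  code⇒≡ t σ u s eq with u Fin.≟ t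
  ... | yes u≡t = u≡t

  -- Some edge of block `t` touches `s`, so the first pair is within 2 of it. A second pair with no
  -- end in block `t` would be 4 away.
  code-occupied : ∀ {t s u₂ s₂ v₁ r₁ v₂ r₂} →
    (∀ σ → dist₁₁ (code t σ t s) (code t σ u₂ s₂) ≡ dist₁₁ (code t σ v₁ r₁) (code t σ v₂ r₂)) →
    v₁ ≡ t ⊎ v₂ ≡ t
  code-occupied {t} {s} {u₂} {s₂} {v₁} {r₁} {v₂} {r₂} same
    with σ , σ∋s ← meets-some s
    with dist₁₁-occupied (code t σ u₂ s₂) (code t σ v₁ r₁) (code t σ v₂ r₂)
           (trans (cong (λ b → dist₁₁ b (code t σ u₂ s₂)) (sym (trans (code-same t σ s) σ∋s))) (same σ))
  ... | inj₁ eq = inj₁ (code⇒≡ t σ v₁ r₁ eq)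
  ... | inj₂ eq = inj₂ (code⇒≡ t σ v₂ r₂ eq)

  -- An edge touching the first point also touches the second, so the blocks agree; within the block
  -- `meets-determines` applies.
  code-determines : ∀ {u s v r} → (∀ t σ → code t σ u s ≡ code t σ v r) → u ≡ v × s ≡ r
  code-determines {u} {s} {v} {r} same with σ , σ∋s ← meets-some s
    with refl ← code⇒≡ u σ v r (trans (sym (same u σ)) (trans (code-same u σ s) σ∋s)) =
    refl , meets-determines s r λ σ → trans (sym (code-same u σ s)) (trans (same u σ) (code-same u σ r))

  private
    SamePair : (u₁ : Fin k) (s₁ : Fin 3) (u₂ : Fin k) (s₂ : Fin 3)
               (v₁ : Fin k) (r₁ : Fin 3) (v₂ : Fin k) (r₂ : Fin 3) → Set
    SamePair u₁ s₁ u₂ s₂ v₁ r₁ v₂ r₂ = ∀ t σ →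
      dist₁₁ (code t σ u₁ s₁) (code t σ u₂ s₂) ≡ dist₁₁ (code t σ v₁ r₁) (code t σ v₂ r₂)

  -- If both remaining ends lie in block `u`, the one-block result applies. Otherwise the occupied
  -- blocks must agree, and each of them sees a single end of either pair.
  code-determines-pair-aligned : ∀ {u s₁ u₂ s₂ r₁ v₂ r₂} →
    (u , s₁) ≢ (u₂ , s₂) → (u , r₁) ≢ (v₂ , r₂) → SamePair u s₁ u₂ s₂ u r₁ v₂ r₂ →
    ((u , s₁) ≡ (u , r₁) × (u₂ , s₂) ≡ (v₂ , r₂)) ⊎ ((u , s₁) ≡ (v₂ , r₂) × (u₂ , s₂) ≡ (u , r₁))
  code-determines-pair-aligned {u} {s₁} {u₂} {s₂} {r₁} {v₂} {r₂} x≢ y≢ same with u₂ Fin.≟ u | v₂ Fin.≟ u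
  ... | yes refl | yes refl
    with meets-determines-pair s₁ s₂ r₁ r₂ (x≢ ∘ cong (u ,_)) (y≢ ∘ cong (u ,_)) (λ σ →
      trans (cong₂ dist₁₁ (sym (code-same u σ s₁)) (sym (code-same u σ s₂)))
        (trans (same u σ) (cong₂ dist₁₁ (code-same u σ r₁) (code-same u σ r₂))))
  ...   | inj₁ (refl , refl) = inj₁ (refl , refl)
  ...   | inj₂ (refl , refl) = inj₂ (refl , refl)
  code-determines-pair-aligned {u} {s₁} {u₂} {s₂} {r₁} {v₂} {r₂} x≢ y≢ same
      | yes refl | no v₂≢u
    -- Block `v₂` is met by the second pair but not by the first. Commuting `dist₁₁` brings the end
    -- in that block to the front.
    with code-occupied {v₂} {r₂} {u} {r₁} {u} {s₁} {u} {s₂}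
           (λ σ → trans (dist₁₁-comm (code v₂ σ v₂ r₂) _) (sym (same v₂ σ)))
  ...   | inj₁ u≡v₂ = contradiction (sym u≡v₂) v₂≢u
  ...   | inj₂ u≡v₂ = contradiction (sym u≡v₂) v₂≢u
  code-determines-pair-aligned {u} {s₁} {u₂} {s₂} {r₁} {v₂} {r₂} x≢ y≢ same
      | no u₂≢u | _
    with code-occupied {u₂} {s₂} {u} {s₁} {u} {r₁} {v₂} {r₂}
           (λ σ → trans (dist₁₁-comm (code u₂ σ u₂ s₂) _) (same u₂ σ))
  ...   | inj₁ u≡u₂ = contradiction (sym u≡u₂) u₂≢u
  ...   | inj₂ refl = inj₁ (cong (u ,_) s₁≡r₁ , cong (u₂ ,_) s₂≡r₂)
    where
    s₁≡r₁ : s₁ ≡ r₁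
    -- In block `u` the other ends contribute `false`, so the distance reveals the bit of the first
    -- end.
    s₁≡r₁ = meets-determines s₁ r₁ λ σ → dist₁₁-cancelʳ (meets σ s₁) (meets σ r₁)
      (trans (cong₂ dist₁₁ (sym (code-same u σ s₁)) (sym (code-other σ s₂ u₂≢u)))
        (trans (same u σ) (cong₂ dist₁₁ (code-same u σ r₁) (code-other σ r₂ u₂≢u))))
    s₂≡r₂ : s₂ ≡ r₂
    s₂≡r₂ = meets-determines s₂ r₂ λ σ → dist₁₁-cancelˡ (meets σ s₂) (meets σ r₂)
      (trans (cong₂ dist₁₁ (sym (code-other σ s₁ (u₂≢u ∘ sym))) (sym (code-same u₂ σ s₂)))
        (trans (same u₂ σ) (cong₂ dist₁₁ (code-other σ r₁ (u₂≢u ∘ sym)) (code-same u₂ σ r₂))))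

  -- The block of the first end holds an end of the other pair; reversing that pair if necessary
  -- aligns the two.
  code-determines-pair : ∀ {u₁ s₁ u₂ s₂ v₁ r₁ v₂ r₂} →
    (u₁ , s₁) ≢ (u₂ , s₂) → (v₁ , r₁) ≢ (v₂ , r₂) → SamePair u₁ s₁ u₂ s₂ v₁ r₁ v₂ r₂ →
    ((u₁ , s₁) ≡ (v₁ , r₁) × (u₂ , s₂) ≡ (v₂ , r₂)) ⊎ ((u₁ , s₁) ≡ (v₂ , r₂) × (u₂ , s₂) ≡ (v₁ , r₁))
  code-determines-pair {u₁} {s₁} {u₂} {s₂} {v₁} {r₁} {v₂} {r₂} x≢ y≢ same
    with code-occupied {u₁} {s₁} {u₂} {s₂} {v₁} {r₁} {v₂} {r₂} (same u₁)
  ... | inj₁ refl = code-determines-pair-aligned x≢ y≢ same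
  ... | inj₂ refl = swap (code-determines-pair-aligned x≢ (y≢ ∘ sym)
    λ t σ → trans (same t σ) (dist₁₁-comm (code t σ v₁ r₁) _))

  -- The resolving set of block edges.

  edge : Fin k → Fin 2 → HVertex (k * 3)
  edge t σ = pair (combine t (inject₁ σ)) (combine t (suc σ)) (begin-strict
    toℕ (combine t (inject₁ σ)) ≡⟨ Fin.toℕ-combine t (inject₁ σ) ⟩
    3 * toℕ t + toℕ (inject₁ σ) <⟨ ℕ.+-monoʳ-< (3 * toℕ t) (ℕ.≤-reflexive (cong suc (Fin.toℕ-inject₁ σ))) ⟩
    3 * toℕ t + toℕ (suc σ)     ≡⟨ Fin.toℕ-combine t (suc σ) ⟨
    toℕ (combine t (suc σ))     ∎)
    where open ℕ.≤-Reasoning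

  combine-≟ : ∀ (u : Fin k) (s : Fin 3) t r →
    does (combine u s Fin.≟ combine t r) ≡ does (u Fin.≟ t) ∧ does (s Fin.≟ r)
  combine-≟ u s t r = does-⇔ (mk⇔ (Fin.combine-injective u s t r) λ { (refl , refl) → refl })
    (combine u s Fin.≟ combine t r) ((u Fin.≟ t) ×-dec (s Fin.≟ r))

  inc-edge : ∀ t σ u s → inc (edge t σ) (combine u s) ≡ code t σ u s
  inc-edge t σ u s = trans (cong₂ _∨_ (combine-≟ u s t (inject₁ σ)) (combine-≟ u s t (suc σ)))
    (sym (∧-distribˡ-∨ (does (u Fin.≟ t)) _ _))

  edges-resolve : ∀ (x y : HVertex (k * 3)) → (∀ t σ → dist x (edge t σ) ≡ dist y (edge t σ)) → x ≡ y
  edges-resolve (point a) (point b) same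
    with u , s , refl ← Fin.combine-surjective {k} {3} a | v , r , refl ← Fin.combine-surjective {k} {3} b
    with refl , refl ← code-determines {u} {s} {v} {r} (λ t σ →
      trans (sym (inc-edge t σ u s)) (trans (dist₀₁-injective _ _ (same t σ)) (inc-edge t σ v r))) = refl
  -- Any block edge separates a point from a pair by parity; decomposing `a` exhibits a block to
  -- take it from.
  edges-resolve (point a) (pair i j _) same with u , _ ← Fin.combine-surjective {k} {3} a =
    contradiction (same u 0F) (dist₀₁≢dist₁₁ (inc e a) (inc e i) (inc e j))
    where e = edge u 0F
  edges-resolve (pair i j _) (point b) same with v , _ ← Fin.combine-surjective {k} {3} b =
    contradiction (sym (same v 0F)) (dist₀₁≢dist₁₁ (inc e b) (inc e i) (inc e j))
    where e = edge v 0F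
  edges-resolve (pair a b a<b) (pair c d c<d) same
    with u₁ , s₁ , refl ← Fin.combine-surjective {k} {3} a | u₂ , s₂ , refl ← Fin.combine-surjective {k} {3} b
       | v₁ , r₁ , refl ← Fin.combine-surjective {k} {3} c | v₂ , r₂ , refl ← Fin.combine-surjective {k} {3} d
    with code-determines-pair {u₁} {s₁} {u₂} {s₂} {v₁} {r₁} {v₂} {r₂}
           (λ { refl → ⊥-elim-irr (Fin.<-irrefl refl a<b) }) (λ { refl → ⊥-elim-irr (Fin.<-irrefl refl c<d) })
           (λ t σ → trans (sym (cong₂ dist₁₁ (inc-edge t σ u₁ s₁) (inc-edge t σ u₂ s₂)))
             (trans (same t σ) (cong₂ dist₁₁ (inc-edge t σ v₁ r₁) (inc-edge t σ v₂ r₂))))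
  ... | inj₁ (refl , refl) = refl
  -- The crossed match would give both `a < b` and `b < a`.
  ... | inj₂ (refl , refl) = ⊥-elim-irr (Fin.<-asym a<b c<d)

  -- The left end alone already determines the block and the edge.
  edge-injective : ∀ {t σ u τ} → edge t σ ≡ edge u τ → t ≡ u × σ ≡ τ
  edge-injective {t} {σ} {u} {τ} eq
    with t≡u , σ≡τ ← Fin.combine-injective t (inject₁ σ) u (inject₁ τ) (pair-injectiveˡ eq) =
    t≡u , Fin.inject₁-injective σ≡τ

  -- Tabulating over `Fin (k * 2)` fixes the length at `k * 2`; `remQuot` splits an index into block
  -- and edge.
  edges : List (HVertex (k * 3))
  edges = tabulate (uncurry edge ∘ remQuot {k} 2)

  edge∈edges : ∀ t σ → edge t σ ∈ edges
  edge∈edges t σ = subst (_∈ edges) (cong (uncurry edge) (Fin.remQuot-combine t σ)) (∈-tabulate⁺ (combine t σ))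

  edges-unique : Unique edges
  edges-unique = tabulate⁺ λ {i} {j} eq → let t≡u , σ≡τ = edge-injective eq in
    trans (sym (Fin.combine-remQuot {k} 2 i)) (trans (cong₂ combine t≡u σ≡τ) (Fin.combine-remQuot {k} 2 j))

  edges-resolving : IsResolving (H (k * 3)) edges
  edges-resolving x y x≢y same = x≢y (edges-resolve x y λ t σ →
    sameDistance⇒≡dist {x = x} {y} (same (edge t σ) (edge∈edges t σ)))

theorem3p7 : (n : ℕ) → n ≥ 6 → 3 ∣ n → IsMetricDimension (H n) (n ∸ (n / 3))
theorem3p7 .(k * 3) _ (divides k refl) = subst (IsMetricDimension (H (k * 3))) (sym size)
  ( (edges {k} , edges-unique {k} , edges-resolving {k} , length-tabulate (uncurry (edge {k}) ∘ remQuot {k} 2))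
  , λ { m (Q , _ , resolving , refl) → lower-bound k m (resolving-size resolving) })
  where
  size : k * 3 ∸ k * 3 / 3 ≡ k * 2
  size = begin
    k * 3 ∸ k * 3 / 3 ≡⟨ cong (k * 3 ∸_) (m*n/n≡m k 3) ⟩
    -- With `k` written as `k * 1` the factor `k` comes out, and `k * (3 ∸ 1)` computes to `k * 2`.
    k * 3 ∸ k         ≡⟨ cong (k * 3 ∸_) (ℕ.*-identityʳ k) ⟨
    k * 3 ∸ k * 1     ≡⟨ ℕ.*-distribˡ-∸ k 3 1 ⟨
    k * 2             ∎
    where open ≡-Reasoning
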